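{- For every $\varepsilon>0$ there exists $\Delta_{\varepsilon}$ such that for every graph $G$ with maximum degree $\Delta\ge\Delta_{\varepsilon}$, $$\chi'_{\rm cf}(G)\leq (1+\varepsilon)\log_2\Delta.$$
   Context: All graphs are simple and finite. For an edge $e=uv$ of $G=(V,E)$, let $E(x)$ denote the set of edges incident with a vertex $x$; the closed neighbourhood of $e$ is $E[e]=E(u)\cup E(v)$ and its open neighbourhood is $E(e)=E[e]\setminus\{e\}$. An edge $e$ is isolated if $E(e)=\emptyset$. Given a (possibly partial) edge colouring $c$ of $G$ (not every edge need receive a colour), a colour $\alpha$ is unique for an edge $e$ if there is an edge $e'\in E(e)$ coloured $\alpha$ and no other edge of $E[e]\setminus\{e'\}$ is coloured $\alpha$; $e$ is satisfied by $c$ if some colour is unique for $e$. An edge colouring of all edges of $G$ is conflict-free if every non-isolated edge of $G$ is satisfied. The conflict-free chromatic index $\chi'_{\rm cf}(G)$ is the minimum number of colours in a conflict-free colouring of all edges of $G$. -}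

module Defs where

open import Data.Nat using (ℕ; zero; suc; _+_; _⊔_)
open import Data.Bool using (Bool; true; false; if_then_else_)
open import Data.Fin using (Fin)
open import Data.List using (List; map; foldr; allFin)
open import Data.Nat.ListAction using (sum)
open import Data.Product using (Σ; ∃; ∃-syntax; _×_; _,_)
open import Data.Sum using (_⊎_)
open import Relation.Nullary using (¬_)
open import Relation.Binary.PropositionalEquality using (_≡_)

record Graph : Set where
  field
    n     : ℕ
    adj   : Fin n → Fin n → Bool
    sym   : ∀ u v → adj u v ≡ adj v u
    irrefl : ∀ u → adj u u ≡ false

module _ (G : Graph) where
  open Graph G

  Edge : Fin n → Fin n → Set
  Edge u v = adj u v ≡ true

  SameEdge : Fin n → Fin n → Fin n → Fin n → Set
  SameEdge x y u v = (x ≡ u × y ≡ v) ⊎ (x ≡ v × y ≡ u)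

  Incident : Fin n → Fin n → Fin n → Set
  Incident x a b = (a ≡ x) ⊎ (b ≡ x)

  InClosedNbhd : Fin n → Fin n → Fin n → Fin n → Set
  InClosedNbhd u v a b = Edge a b × (Incident u a b ⊎ Incident v a b)

  InOpenNbhd : Fin n → Fin n → Fin n → Fin n → Set
  InOpenNbhd u v a b = InClosedNbhd u v a b × ¬ SameEdge a b u v

  NonIsolated : Fin n → Fin n → Set
  NonIsolated u v = ∃[ a ] ∃[ b ] InOpenNbhd u v a b

  -- An edge colouring of all edges of G with colours from Fin k.
  -- It is a function on ordered pairs that is symmetric on edges,
  -- so each (unordered) edge receives exactly one colour.
  record EdgeColouring (k : ℕ) : Set where
    field
      col    : Fin n → Fin n → Fin k
      colSym : ∀ u v → Edge u v → col u v ≡ col v u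

  module _ {k : ℕ} (c : EdgeColouring k) where
    open EdgeColouring c

    UniqueFor : Fin k → Fin n → Fin n → Set
    UniqueFor α u v =
      ∃[ a ] ∃[ b ] (InOpenNbhd u v a b × col a b ≡ α ×
        (∀ x y → InClosedNbhd u v x y → col x y ≡ α → SameEdge x y a b))

    Satisfied : Fin n → Fin n → Set
    Satisfied u v = ∃[ α ] UniqueFor α u v

    ConflictFree : Set
    ConflictFree = ∀ u v → Edge u v → NonIsolated u v → Satisfied u v

  -- χ'_cf(G) ≤ k  iff G has a conflict-free colouring using at most k colours
  HasCFColouring : ℕ → Set
  HasCFColouring k = Σ (EdgeColouring k) ConflictFree

  degree : Fin n → ℕ
  degree v = sum (map (λ u → if adj v u then 1 else 0) (allFin n))

  maxDegree : ℕ
  maxDegree = foldr _⊔_ 0 (map degree (allFin n))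

{-# OPTIONS --safe #-}
module Submission where

-- Take a greedy colouring, with classes 0, 1, …, Δ: each vertex has a designated neighbour in every
-- smaller class. Write T ≈ log₂ Δ. A vertex of class c ≥ T + 2 gives colour i to its edge to class
-- 2 + i when bit i of c is 1, and two further colours to its edges to classes 0 and 1. Two adjacent
-- such vertices differ in some bit, so that colour occurs exactly once around their edge; the two further
-- colours satisfy the edges going down to classes below T + 2. The classes below T + 2 are handled
-- in the same way with S ≈ log₂ T bits, and those below S + 2 with two colours per class, so
-- T + O(S) colours suffice, except on the edges between classes 1 and 0.
-- For these, the designated neighbours of class 1 are taken in a minimal dominating subset (the core)
-- of class 0. Each core vertex s then has a private neighbour, its partner; the edges from s to its partner
-- get a colour of their own, which satisfies the other edges at s. These edges s – partner s form an
-- induced matching, so flagging one edge adjacent to each of them (a flag splits a colour in two)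
-- satisfies them as well.

open import Defs
open import Data.Nat using (ℕ; zero; suc; _+_; _*_; _^_; _≤_; _<_; _⊔_; z≤n; s≤s; _<?_; _≤?_; >-nonZero)
open import Data.Nat.ListAction using (sum)
open import Data.Bool using (Bool; true; false; if_then_else_)
open import Data.Fin using (Fin; toℕ; fromℕ<; finToFun; funToFin; combine)
open import Data.Fin.Properties using (_≟_; any?; all?; ¬∀⟶∃¬; injective⇒≤; toℕ<n; toℕ-injective; toℕ-fromℕ<;
  fromℕ<-injective; funToFin-finToFin; fromℕ<-toℕ; +↔⊎; *↔×; 2↔Bool)
open import Data.List using (List; []; _∷_; map; foldr; allFin; length; filter)
open import Data.List.Membership.Propositional using (_∈_)
open import Data.List.Membership.Propositional.Properties using (∈-allFin; ∈-filter⁺; ∈-map⁺)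
open import Data.List.Relation.Unary.Any using (here; there; index)
open import Data.List.Relation.Unary.Any.Properties using (lookup-index)
open import Data.Product using (Σ; ∃; ∃-syntax; _×_; _,_; proj₁; proj₂)
open import Data.Sum using (_⊎_; inj₁; inj₂; [_,_]′)
open import Data.Unit using (⊤; tt)
open import Function using (_∘_)
open import Level using (0ℓ)
open import Relation.Binary.Definitions using (tri<; tri≈; tri>) renaming (Decidable to Decidable₂)
open import Relation.Nullary using (¬_; Dec; yes; no; does)
open import Relation.Nullary.Decidable using (_×-dec_; _→-dec_; ¬?; dec-true; dec-false; decidable-stable; _⊎-dec_)
open import Relation.Nullary.Negation using (contradiction)
open import Relation.Unary using (Pred; Decidable)
open import Relation.Binary.PropositionalEquality using (_≡_; _≢_; refl; sym; trans; cong; cong₂; subst;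
  module ≡-Reasoning)
open import Data.Nat.DivMod using (_mod_; m<n⇒m%n≡m; _%_)
open import Data.Nat.Solver using (module +-*-Solver)
open import Data.Maybe using (Maybe; just; nothing; maybe′) renaming (map to map?)
open import Data.Maybe.Properties using (just-injective)
open import Data.Sum.Properties using (inj₁-injective; inj₂-injective)
open import Data.Product.Function.NonDependent.Propositional using (_×-↔_)
open import Data.Sum.Function.Propositional using (_⊎-↔_)
open import Function.Bundles using (_↔_; module Inverse)
open import Function.Construct.Composition using (_↔-∘_)
open import Function.Construct.Symmetry using (↔-sym)
import Data.Nat.Properties as ℕ
import Data.Bool.Properties as Bool
import Data.List.Membership.DecPropositional as DecMembership
import Data.List as List

-- Finite search and minimal dominating sets

least-failure : {P : Pred ℕ 0ℓ} → Decidable P → ∀ m →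
  (∀ k → k < m → P k) ⊎ ∃[ k ] (¬ P k × (∀ j → j < k → P j))
least-failure P? zero = inj₁ λ _ ()
least-failure {P} P? (suc m) with least-failure P? m
... | inj₂ found = inj₂ found
... | inj₁ below with P? m
...   | no ¬pm = inj₂ (m , ¬pm , below)
...   | yes pm = inj₁ λ k k<1+m → [ below k , (λ { refl → pm }) ]′ (ℕ.m<1+n⇒m<n∨m≡n k<1+m)

minimal-dominating : ∀ {m n} {E : Fin m → Fin n → Set} → Decidable₂ E →
  Σ (Pred (Fin n) 0ℓ) λ S → Decidable S ×
    (∀ y x → E y x → ∃[ s ] (S s × E y s)) ×
    (∀ s → S s → ∃[ y ] (E y s × (∀ s′ → S s′ → E y s′ → s′ ≡ s)))
minimal-dominating {m} {n} {E} E? =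
  let S , S? , dominating , private-on = prune (allFin n)
  in  S , S? , dominating , λ s → private-on s (∈-allFin s)
  where
  Private : Pred (Fin n) 0ℓ → Fin n → Set
  Private S s = ∃[ y ] (E y s × (∀ s′ → S s′ → E y s′ → s′ ≡ s))

  private? : ∀ {S} → Decidable S → Decidable (Private S)
  private? S? s = any? λ y → E? y s ×-dec all? (λ s′ → S? s′ →-dec (E? y s′ →-dec (s′ ≟ s)))

  prune : (xs : List (Fin n)) → Σ (Pred (Fin n) 0ℓ) λ S → Decidable S ×
    (∀ y x → E y x → ∃[ s ] (S s × E y s)) × (∀ s → s ∈ xs → S s → Private S s)
  prune [] = (λ _ → ⊤) , (λ _ → yes tt) , (λ y x e → x , tt , e) , λ _ ()
  prune (x ∷ xs) with prune xs
  ... | S , S? , dominating , private-on with private? S? x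
  ...   | yes p = S , S? , dominating , λ { _ (here refl) _ → p ; s (there s∈) → private-on s s∈ }
  ...   | no ¬p = S′ , (λ s → S? s ×-dec ¬? (s ≟ x)) , dominating′ , private-on′
    where
    S′ : Pred (Fin n) 0ℓ
    S′ s = S s × s ≢ x

    dominating′ : ∀ y z → E y z → ∃[ s ] (S′ s × E y s)
    dominating′ y z e with dominating y z e
    ... | s , Ss , ys with s ≟ x
    ...   | no s≢x = s , (Ss , s≢x) , ys
    ...   | yes refl with any? (λ s′ → S? s′ ×-dec (E? y s′ ×-dec ¬? (s′ ≟ s)))
    ...     | yes (s′ , Ss′ , ys′ , s′≢s) = s′ , (Ss′ , s′≢s) , ys′
    -- If `s` alone dominated `y`, then `y` would be private to it.
    ...     | no none = contradiction (y , ys , λ s′ Ss′ ys′ →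
                decidable-stable (s′ ≟ s) λ s′≢s → none (s′ , Ss′ , ys′ , s′≢s)) ¬p

    private-on′ : ∀ s → s ∈ x ∷ xs → S′ s → Private S′ s
    private-on′ s (here s≡x) (_ , s≢x) = contradiction s≡x s≢x
    private-on′ s (there s∈) (Ss , _) with private-on s s∈ Ss
    ... | y , ys , only = y , ys , λ s′ (Ss′ , _) → only s′ Ss′

-- Binary codes for the classes

-- Which of the edges to its designated neighbours a vertex colours, as a function of its class c:
-- those to classes 0 and 1 always, with colours shared by the level of c, and the one
-- to class 2 + i with colour hi c i, if any.
record Code (N : ℕ) (L H : Set) : Set where
  field
    lev    : ℕ → L
    hi     : ℕ → ℕ → Maybe H
    lev-1  : ∀ {c} → 0 < c → lev c ≡ lev 1 → c ≡ 1
    hi-inj : ∀ {c d i j α} → hi c i ≡ just α → hi d j ≡ just α → i ≡ j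
    -- The bound `2 + i < d` ensures that both vertices have a designated neighbour in class `2 + i`
    -- and that neither lies in that class.
    hi-sep : ∀ {c d} → 2 ≤ d → d < c → c < N →
             lev c ≢ lev d ⊎ ∃[ i ] (2 + i < d × hi c i ≢ hi d i)

funToFin-cong : ∀ {m n} {f g : Fin m → Fin n} → (∀ i → f i ≡ g i) → funToFin f ≡ funToFin g
funToFin-cong {zero} f≗g = refl
funToFin-cong {suc m} f≗g = cong₂ combine (f≗g Fin.zero) (funToFin-cong (f≗g ∘ Fin.suc))

digit : (m c : ℕ) → Fin m → Fin 2
digit m c = finToFun (_mod_ c (2 ^ m) {{ℕ.m^n≢0 2 m}})

digits-separate : ∀ m {c d} → c < 2 ^ m → d < 2 ^ m → c ≢ d → ∃[ i ] digit m c i ≢ digit m d i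
digits-separate m {c} {d} c< d< c≢d = ¬∀⟶∃¬ m _ (λ i → digit m c i ≟ digit m d i) λ same →
  c≢d (begin
    c                                ≡⟨ recover c c< ⟩
    toℕ (funToFin {m} (digit m c))   ≡⟨ cong toℕ (funToFin-cong {m} same) ⟩
    toℕ (funToFin {m} (digit m d))   ≡⟨ recover d d< ⟨
    d                                ∎)
  where
  open ≡-Reasoning
  instance _ = ℕ.m^n≢0 2 m
  recover : ∀ e → e < 2 ^ m → e ≡ toℕ (funToFin {m} (digit m e))
  recover e e< = begin
    e                                ≡⟨ m<n⇒m%n≡m e< ⟨
    e % 2 ^ m                        ≡⟨ toℕ-fromℕ< _ ⟨
    toℕ (e mod 2 ^ m)                ≡⟨ cong toℕ (funToFin-finToFin {m} (e mod 2 ^ m)) ⟨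
    toℕ (funToFin {m} (digit m e))   ∎

-- Only a bit 1 is given a colour, so each position costs one colour instead of two. This is what
-- makes the coefficient of the logarithm equal to 1.
one-bits : (m c i : ℕ) → Maybe (Fin m)
one-bits m c i with i <? m
... | no _ = nothing
... | yes i<m with digit m c (fromℕ< i<m)
...   | Fin.zero = nothing
...   | Fin.suc _ = just (fromℕ< i<m)

one-bits-toℕ : ∀ {m c i k} → one-bits m c i ≡ just k → i ≡ toℕ k
one-bits-toℕ {m} {c} {i} eq with i <? m
... | yes i<m with digit m c (fromℕ< i<m) | eq
...   | Fin.suc _ | refl = sym (toℕ-fromℕ< i<m)

one-bits-separate : ∀ m {c d} → c < 2 ^ m → d < 2 ^ m → c ≢ d →
  ∃[ i ] (i < m × one-bits m c i ≢ one-bits m d i)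
one-bits-separate m {c} {d} c< d< c≢d with digits-separate m c< d< c≢d
... | k , digits≢ = toℕ k , toℕ<n k , bits≢
  where
  bits≢ : one-bits m c (toℕ k) ≢ one-bits m d (toℕ k)
  bits≢ eq with toℕ k <? m
  ... | no k≮m = k≮m (toℕ<n k)
  ... | yes k<m rewrite fromℕ<-toℕ k k<m with digit m c k | digit m d k
  ...   | Fin.zero | Fin.zero = digits≢ refl
  ...   | Fin.suc Fin.zero | Fin.suc Fin.zero = digits≢ refl
  bits≢ () | yes k<m | Fin.zero | Fin.suc _
  bits≢ () | yes k<m | Fin.suc _ | Fin.zero

map?-injective : ∀ {A B : Set} {f : A → B} → (∀ {a b} → f a ≡ f b → a ≡ b) →
  ∀ x y → map? f x ≡ map? f y → x ≡ y
map?-injective inj nothing nothing _ = refl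
map?-injective inj (just a) (just b) eq = cong just (inj (just-injective eq))

module _ (S T : ℕ) (T+2≤2^S : 2 + T ≤ 2 ^ S) where

  -- The thresholds make room for the digits: a class from `2 + S` on has designated neighbours in
  -- all of the classes 2 to `1 + S`, one per bit, and likewise with `T`. Small classes are told
  -- apart by their levels alone.
  data Range (c : ℕ) : Set where
    small : c < 2 + S → Range c
    mid   : 2 + S ≤ c → c < 2 + T → Range c
    large : 2 + T ≤ c → Range c

  range : ∀ c → Range c
  range c with c <? 2 + S | c <? 2 + T
  ... | yes c<  | _       = small c<
  ... | no c≮   | yes c<  = mid (ℕ.≮⇒≥ c≮) c<
  ... | no _    | no c≮   = large (ℕ.≮⇒≥ c≮)

  Level : Set
  Level = Fin (2 + S) ⊎ Fin 2

  level-in : ∀ {c} → Range c → Level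
  level-in (small c<) = inj₁ (fromℕ< c<)
  level-in (mid _ _)  = inj₂ Fin.zero
  level-in (large _)  = inj₂ (Fin.suc Fin.zero)

  high-in : ∀ {c} → Range c → ℕ → Maybe (Fin S ⊎ Fin T)
  high-in {c} (small _) i = nothing
  high-in {c} (mid _ _) i = map? inj₁ (one-bits S c i)
  high-in {c} (large _) i = map? inj₂ (one-bits T c i)

  high-in-toℕ : ∀ {c i α} (r : Range c) → high-in r i ≡ just α → i ≡ [ toℕ , toℕ ]′ α
  high-in-toℕ {c} {i} (mid _ _) eq with one-bits S c i in bits
  high-in-toℕ (mid _ _) refl | just k = one-bits-toℕ {S} bits
  high-in-toℕ {c} {i} (large _) eq with one-bits T c i in bits
  high-in-toℕ (large _) refl | just k = one-bits-toℕ {T} bits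

  -- Levels separate classes of different ranges and any two small classes. Within the mid range `S`
  -- bits suffice because `2 + T ≤ 2 ^ S`, and within the large range `T` bits because `c < 2 ^ T`.
  high-in-separates : ∀ {c d} (r : Range c) (s : Range d) → d < c → c < 2 ^ T →
    level-in r ≢ level-in s ⊎ ∃[ i ] (2 + i < d × high-in r i ≢ high-in s i)
  high-in-separates {c} {d} (small c<) (small d<) d<c _ = inj₁ λ eq →
    ℕ.<⇒≢ d<c (sym (fromℕ<-injective c d c< d< (inj₁-injective eq)))
  high-in-separates (mid _ c<) (mid ≤d _) d<c _
    with one-bits-separate S (ℕ.<-≤-trans c< T+2≤2^S) (ℕ.<-≤-trans (ℕ.<-trans d<c c<) T+2≤2^S) (ℕ.<⇒≢ d<c ∘ sym)
  ... | i , i<S , bits≢ = inj₂ (i , ℕ.<-≤-trans (s≤s (s≤s i<S)) ≤d , bits≢ ∘ map?-injective inj₁-injective _ _)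
  high-in-separates (large _) (large ≤d) d<c c<
    with one-bits-separate T c< (ℕ.<-trans d<c c<) (ℕ.<⇒≢ d<c ∘ sym)
  ... | i , i<T , bits≢ = inj₂ (i , ℕ.<-≤-trans (s≤s (s≤s i<T)) ≤d , bits≢ ∘ map?-injective inj₂-injective _ _)
  high-in-separates (small _) (mid _ _) _ _ = inj₁ λ ()
  high-in-separates (small _) (large _) _ _ = inj₁ λ ()
  high-in-separates (mid _ _) (small _) _ _ = inj₁ λ ()
  high-in-separates (mid _ _) (large _) _ _ = inj₁ λ ()
  high-in-separates (large _) (small _) _ _ = inj₁ λ ()
  high-in-separates (large _) (mid _ _) _ _ = inj₁ λ ()

  level-in-1 : ∀ {c} (r : Range c) (r₁ : Range 1) → level-in r ≡ level-in r₁ → c ≡ 1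
  level-in-1 {c} (small c<) (small 1<) eq = fromℕ<-injective c 1 c< 1< (inj₁-injective eq)
  level-in-1 r (mid (s≤s ()) _)
  level-in-1 r (large (s≤s ()))

  binary-code : Code (2 ^ T) Level (Fin S ⊎ Fin T)
  binary-code = record
    { lev    = λ c → level-in (range c)
    ; hi     = λ c → high-in (range c)
    ; lev-1  = λ {c} _ → level-in-1 (range c) (range 1)
    ; hi-inj = λ {c} {d} p q → trans (high-in-toℕ (range c) p) (sym (high-in-toℕ (range d) q))
    ; hi-sep = λ {c} {d} _ → high-in-separates (range c) (range d)
    }

-- Estimates for the number of colours

binary-magnitude : ∀ m → ∃[ t ] (suc m ≤ 2 ^ t × 2 ^ t ≤ 2 * suc m)
binary-magnitude zero = 0 , s≤s z≤n , s≤s z≤n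
binary-magnitude (suc m) with binary-magnitude m
... | t , lower , upper with 2 + m ≤? 2 ^ t
...   | yes lower′ = t , lower′ , ℕ.≤-trans upper (ℕ.*-monoʳ-≤ 2 (ℕ.n≤1+n (suc m)))
...   | no ¬lower′ = suc t ,
          ℕ.≤-trans (s≤s (s≤s (ℕ.m≤m+n m _))) (ℕ.≤-trans (ℕ.≤-reflexive doubled) (ℕ.*-monoʳ-≤ 2 lower)) ,
          ℕ.*-monoʳ-≤ 2 (ℕ.<⇒≤ (ℕ.≰⇒> ¬lower′))
  where
  doubled : 2 + (m + m) ≡ 2 * suc m
  doubled = solve 1 (λ m → con 2 :+ (m :+ m) := con 2 :* (con 1 :+ m)) refl m
    where open +-*-Solver

n<2^n : ∀ n → n < 2 ^ n
n<2^n zero = s≤s z≤n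
n<2^n (suc n) = ℕ.≤-trans (ℕ.+-mono-≤ (ℕ.m^n>0 2 n) (n<2^n n))
  (ℕ.+-monoʳ-≤ (2 ^ n) (ℕ.m≤m+n (2 ^ n) 0))

-- Induction on the slope: of the two copies of `2 ^ s` in `2 ^ suc s`, one bounds the line of
-- smaller slope and the other the extra `suc s`.
linear≤exponential : ∀ a b → ∃[ s₀ ] (∀ s → s₀ ≤ s → a * s + b ≤ 2 ^ s)
linear≤exponential zero b = b , λ s b≤s → ℕ.≤-trans b≤s (ℕ.<⇒≤ (n<2^n s))
linear≤exponential (suc a) b with linear≤exponential a (a + b)
... | s₀ , bound = suc s₀ , λ { (suc s) (s≤s s₀≤s) → begin
    suc a * suc s + b         ≡⟨ rearrange a b s ⟩
    (a * s + (a + b)) + suc s ≤⟨ ℕ.+-mono-≤ (bound s s₀≤s) (n<2^n s) ⟩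
    2 ^ s + 2 ^ s             ≡⟨ cong (2 ^ s +_) (ℕ.+-identityʳ (2 ^ s)) ⟨
    2 ^ suc s                 ∎ }
  where
  open ℕ.≤-Reasoning
  rearrange : ∀ a b s → suc a * suc s + b ≡ (a * s + (a + b)) + suc s
  rearrange = solve 3 (λ a b s → (con 1 :+ a) :* (con 1 :+ s) :+ b := (a :* s :+ (a :+ b)) :+ (con 1 :+ s)) refl
    where open +-*-Solver

2^-cancel-≤ : ∀ {m n} → 2 ^ m ≤ 2 ^ n → m ≤ n
2^-cancel-≤ le = ℕ.≮⇒≥ λ n<m → ℕ.<⇒≱ (ℕ.^-monoʳ-< 2 (s≤s (s≤s z≤n)) n<m) le

^-distribʳ-* : ∀ k m n → (m * n) ^ k ≡ m ^ k * n ^ k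
^-distribʳ-* zero m n = refl
^-distribʳ-* (suc k) m n = trans (cong (m * n *_) (^-distribʳ-* k m n))
  (solve 4 (λ a b c d → a :* b :* (c :* d) := a :* c :* (b :* d)) refl m n (m ^ k) (n ^ k))
  where open +-*-Solver

-- The number of colours is `T + (5 * S + 20)`. The part `T` yields `Δ ^ suc q` up to a factor
-- `4 ^ suc q`; this factor and the part linear in `S`, which is doubly logarithmic in `Δ`, are
-- absorbed by one further factor `Δ`.
few-colours : ∀ p q → ∃[ D ] (∀ Δ S T → D ≤ Δ → suc Δ ≤ 2 ^ T → 2 ^ T ≤ 2 * suc Δ →
  2 + T ≤ 2 ^ S → 2 ^ S ≤ 2 * (2 + T) →
  2 ^ ((S + T + ((2 + S + 2) * 2 + 2) * 2) * suc q) ≤ Δ ^ (suc q + suc p))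
-- This line is twice `(5 * S + 22) * suc q + 4`, to match the 2 in `2 ^ S ≤ 2 * (2 + T)`. Here 22
-- is 20 plus 2 for the factor 4, and the last 4 covers the 2 in `2 + T` and the loss in
-- `2 ^ T ≤ Δ * 4`.
few-colours p q with linear≤exponential (10 * suc q) (44 * suc q + 8)
-- Such a `Δ` forces `2 ^ s₀ ≤ T`, and hence `s₀ ≤ S`.
... | s₀ , bound = 2 ^ (2 ^ s₀) , enough
  where
  open ℕ.≤-Reasoning
  open +-*-Solver

  split-exponent : ∀ S T → (S + T + ((2 + S + 2) * 2 + 2) * 2) * suc q ≡ T * suc q + (5 * S + 20) * suc q
  split-exponent S T = solve 3 (λ S T q → (S :+ T :+ ((con 2 :+ S :+ con 2) :* con 2 :+ con 2) :* con 2) :* (con 1 :+ q)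
    := T :* (con 1 :+ q) :+ (con 5 :* S :+ con 20) :* (con 1 :+ q)) refl S T q

  double : ∀ S → 10 * suc q * S + (44 * suc q + 8) ≡ 2 * ((5 * S + 22) * suc q + 4)
  double S = solve 2 (λ q S → con 10 :* (con 1 :+ q) :* S :+ (con 44 :* (con 1 :+ q) :+ con 8)
    := con 2 :* ((con 5 :* S :+ con 22) :* (con 1 :+ q) :+ con 4)) refl q S

  enough : ∀ Δ S T → 2 ^ (2 ^ s₀) ≤ Δ → suc Δ ≤ 2 ^ T → 2 ^ T ≤ 2 * suc Δ →
    2 + T ≤ 2 ^ S → 2 ^ S ≤ 2 * (2 + T) →
    2 ^ ((S + T + ((2 + S + 2) * 2 + 2) * 2) * suc q) ≤ Δ ^ (suc q + suc p)
  enough Δ S T D≤Δ Δ<2^T 2^T≤ T+2≤2^S 2^S≤ = begin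
    2 ^ ((S + T + ((2 + S + 2) * 2 + 2) * 2) * suc q)
      ≡⟨ cong (2 ^_) (split-exponent S T) ⟩
    2 ^ (T * suc q + (5 * S + 20) * suc q)
      ≡⟨ ℕ.^-distribˡ-+-* 2 (T * suc q) _ ⟩
    2 ^ (T * suc q) * 2 ^ ((5 * S + 20) * suc q)
      ≡⟨ cong₂ _*_ (ℕ.^-*-assoc 2 T (suc q)) (ℕ.^-*-assoc 2 (5 * S + 20) (suc q)) ⟨
    (2 ^ T) ^ suc q * (2 ^ (5 * S + 20)) ^ suc q
      ≤⟨ ℕ.*-monoˡ-≤ _ (ℕ.^-monoˡ-≤ (suc q) 2^T≤4Δ) ⟩
    (Δ * 4) ^ suc q * (2 ^ (5 * S + 20)) ^ suc q
      ≡⟨ cong (_* (2 ^ (5 * S + 20)) ^ suc q) (^-distribʳ-* (suc q) Δ 4) ⟩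
    Δ ^ suc q * 4 ^ suc q * (2 ^ (5 * S + 20)) ^ suc q
      ≡⟨ ℕ.*-assoc (Δ ^ suc q) _ _ ⟩
    Δ ^ suc q * (4 ^ suc q * (2 ^ (5 * S + 20)) ^ suc q)
      ≡⟨ cong (Δ ^ suc q *_) (^-distribʳ-* (suc q) 4 (2 ^ (5 * S + 20))) ⟨
    Δ ^ suc q * (4 * 2 ^ (5 * S + 20)) ^ suc q
      ≡⟨ cong (λ x → Δ ^ suc q * x ^ suc q) (ℕ.^-distribˡ-+-* 2 2 (5 * S + 20)) ⟨
    Δ ^ suc q * (2 ^ (2 + (5 * S + 20))) ^ suc q
      ≡⟨ cong (Δ ^ suc q *_) (trans (ℕ.^-*-assoc 2 (2 + (5 * S + 20)) (suc q)) (cong (λ e → 2 ^ (e * suc q))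
           (solve 1 (λ S → con 2 :+ (con 5 :* S :+ con 20) := con 5 :* S :+ con 22) refl S))) ⟩
    Δ ^ suc q * 2 ^ ((5 * S + 22) * suc q)
      ≤⟨ ℕ.*-monoʳ-≤ (Δ ^ suc q) remainder≤Δ ⟩
    Δ ^ suc q * Δ
      ≡⟨ cong (Δ ^ suc q *_) (ℕ.^-identityʳ Δ) ⟨
    Δ ^ suc q * Δ ^ 1
      ≤⟨ ℕ.*-monoʳ-≤ (Δ ^ suc q) (ℕ.^-monoʳ-≤ Δ {{>-nonZero 1≤Δ}} {1} {suc p} (s≤s z≤n)) ⟩
    Δ ^ suc q * Δ ^ suc p
      ≡⟨ ℕ.^-distribˡ-+-* Δ (suc q) (suc p) ⟨
    Δ ^ (suc q + suc p) ∎
    where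
    1≤Δ : 1 ≤ Δ
    1≤Δ = ℕ.≤-trans (ℕ.m^n>0 2 (2 ^ s₀)) D≤Δ

    2^T≤4Δ : 2 ^ T ≤ Δ * 4
    2^T≤4Δ = begin
      2 ^ T       ≤⟨ 2^T≤ ⟩
      2 * suc Δ   ≤⟨ ℕ.*-monoʳ-≤ 2 (ℕ.+-monoˡ-≤ Δ 1≤Δ) ⟩
      2 * (Δ + Δ) ≡⟨ solve 1 (λ d → con 2 :* (d :+ d) := d :* con 4) refl Δ ⟩
      Δ * 4       ∎

    s₀≤S : s₀ ≤ S
    s₀≤S = 2^-cancel-≤ (ℕ.≤-trans (2^-cancel-≤ (ℕ.≤-trans D≤Δ (ℕ.<⇒≤ Δ<2^T)))
                                  (ℕ.≤-trans (ℕ.m≤n+m T 2) T+2≤2^S))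

    exponent≤T : 2 + (5 * S + 22) * suc q ≤ T
    exponent≤T = ℕ.+-cancelˡ-≤ 2 _ _ (begin
      2 + (2 + (5 * S + 22) * suc q)  ≡⟨ ℕ.+-comm 4 _ ⟩
      (5 * S + 22) * suc q + 4        ≤⟨ ℕ.*-cancelˡ-≤ 2 (ℕ.≤-trans (ℕ.≤-reflexive (sym (double S)))
                                           (ℕ.≤-trans (bound S s₀≤S) 2^S≤)) ⟩
      2 + T                           ∎)

    remainder≤Δ : 2 ^ ((5 * S + 22) * suc q) ≤ Δ
    remainder≤Δ = ℕ.*-cancelˡ-≤ 4 (begin
      4 * 2 ^ ((5 * S + 22) * suc q)  ≡⟨ ℕ.^-distribˡ-+-* 2 2 ((5 * S + 22) * suc q) ⟨
      2 ^ (2 + (5 * S + 22) * suc q)  ≤⟨ ℕ.^-monoʳ-≤ 2 exponent≤T ⟩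
      2 ^ T                           ≤⟨ 2^T≤4Δ ⟩
      Δ * 4                           ≡⟨ ℕ.*-comm Δ 4 ⟩
      4 * Δ                           ∎)

-- Greedy colourings

module _ (G : Graph) where
  open Graph G renaming (sym to adj-sym)

  Edge-sym : ∀ {u v} → Edge G u v → Edge G v u
  Edge-sym {u} {v} uv = trans (adj-sym v u) uv

  Edge? : Decidable₂ (Edge G)
  Edge? u v = adj u v Bool.≟ true

  IsGreedy : (Fin n → ℕ) → Set
  IsGreedy cl = (∀ u v → Edge G u v → cl u ≢ cl v) ×
                (∀ v k → k < cl v → ∃[ w ] (Edge G v w × cl w ≡ k))

  -- Vertices are added one at a time, each receiving the least class absent from its earlier
  -- neighbours.
  greedy-colouring : ∃ IsGreedy
  greedy-colouring =
    let cl , proper , sees = extend (allFin n)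
    in  cl , (λ u v → proper u v (∈-allFin u) (∈-allFin v)) ,
        λ v k k< → let w , _ , vw = sees v k (∈-allFin v) k< in w , vw
    where
    open DecMembership (_≟_ {n}) using (_∈?_)

    GreedyOn : List (Fin n) → (Fin n → ℕ) → Set
    GreedyOn xs cl = (∀ u v → u ∈ xs → v ∈ xs → Edge G u v → cl u ≢ cl v) ×
      (∀ v k → v ∈ xs → k < cl v → ∃[ w ] (w ∈ xs × Edge G v w × cl w ≡ k))

    extend : ∀ xs → ∃ (GreedyOn xs)
    extend [] = (λ _ → 0) , (λ _ _ ()) , λ _ _ ()
    extend (x ∷ xs) with extend xs | x ∈? xs
    ... | cl , proper , sees | yes x∈ = cl , (λ u v u∈ v∈ → proper u v (drop u∈) (drop v∈)) ,
            λ v k v∈ k< → let w , w∈ , p = sees v k (drop v∈) k< in w , there w∈ , p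
      where
      drop : ∀ {u} → u ∈ x ∷ xs → u ∈ xs
      drop (here refl) = x∈
      drop (there u∈) = u∈
    ... | cl , proper , sees | no x∉ = cl′ , proper′ , sees′
      where
      Seen : Pred ℕ 0ℓ
      Seen k = ∃[ w ] (w ∈ xs × Edge G x w × cl w ≡ k)

      mex : ∃[ k ] (¬ Seen k × (∀ j → j < k → Seen j))
      mex with least-failure (λ k → any? λ w → (w ∈? xs) ×-dec (Edge? x w ×-dec (cl w ℕ.≟ k))) (suc n)
      ... | inj₂ found = found
      ... | inj₁ all-seen = contradiction (injective⇒≤ witness-injective) ℕ.1+n≰n
        where
        seen : (i : Fin (suc n)) → Seen (toℕ i)
        seen i = all-seen (toℕ i) (toℕ<n i)

        class-witness : ∀ i → cl (proj₁ (seen i)) ≡ toℕ i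
        class-witness i = proj₂ (proj₂ (proj₂ (seen i)))

        witness-injective : ∀ {i j} → proj₁ (seen i) ≡ proj₁ (seen j) → i ≡ j
        witness-injective {i} {j} eq =
          toℕ-injective (trans (sym (class-witness i)) (trans (cong cl eq) (class-witness j)))

      cl′ : Fin n → ℕ
      cl′ u = if does (u ≟ x) then proj₁ mex else cl u

      cl′-new : cl′ x ≡ proj₁ mex
      cl′-new = cong (λ b → if b then proj₁ mex else cl x) (dec-true (x ≟ x) refl)

      cl′-old : ∀ {u} → u ∈ xs → cl′ u ≡ cl u
      cl′-old {u} u∈ = cong (λ b → if b then proj₁ mex else cl u) (dec-false (u ≟ x) λ { refl → x∉ u∈ })

      new≢old : ∀ v → v ∈ xs → Edge G x v → cl′ x ≢ cl′ v
      new≢old v v∈ xv eq = proj₁ (proj₂ mex)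
        (v , v∈ , xv , trans (sym (cl′-old v∈)) (trans (sym eq) cl′-new))

      proper′ : ∀ u v → u ∈ x ∷ xs → v ∈ x ∷ xs → Edge G u v → cl′ u ≢ cl′ v
      proper′ u v (here refl) (here refl) uv = contradiction (trans (sym uv) (irrefl u)) λ ()
      proper′ u v (here refl) (there v∈) uv = new≢old v v∈ uv
      proper′ u v (there u∈) (here refl) uv = new≢old u u∈ (Edge-sym uv) ∘ sym
      proper′ u v (there u∈) (there v∈) uv eq =
        proper u v u∈ v∈ uv (trans (sym (cl′-old u∈)) (trans eq (cl′-old v∈)))

      sees′ : ∀ v k → v ∈ x ∷ xs → k < cl′ v → ∃[ w ] (w ∈ x ∷ xs × Edge G v w × cl′ w ≡ k)
      sees′ v k (here refl) k<
        with proj₂ (proj₂ mex) k (subst (k <_) cl′-new k<)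
      ... | w , w∈ , vw , eq = w , there w∈ , vw , trans (cl′-old w∈) eq
      sees′ v k (there v∈) k<
        with sees v k v∈ (subst (k <_) (cl′-old v∈) k<)
      ... | w , w∈ , vw , eq = w , there w∈ , vw , trans (cl′-old w∈) eq

  degree≡length : ∀ v → degree G v ≡ length (filter (Edge? v) (allFin n))
  degree≡length v = count (allFin n)
    where
    count : ∀ xs → sum (map (λ u → if adj v u then 1 else 0) xs) ≡ length (filter (Edge? v) xs)
    count [] = refl
    count (x ∷ xs) with adj v x
    ... | true  = cong suc (count xs)
    ... | false = count xs

  degree≤maxDegree : ∀ v → degree G v ≤ maxDegree G
  degree≤maxDegree v = bound (∈-map⁺ (degree G) (∈-allFin v))
    where
    bound : ∀ {d ds} → d ∈ ds → d ≤ foldr _⊔_ 0 ds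
    bound (here refl) = ℕ.m≤m⊔n _ _
    bound {ds = e ∷ ds} (there d∈) = ℕ.≤-trans (bound d∈) (ℕ.m≤n⊔m e _)

  -- The neighbours of `v` in the classes below its own are distinct, so there are at most
  -- `degree G v` such classes.
  greedy-class≤maxDegree : ∀ {cl} → IsGreedy cl → ∀ v → cl v ≤ maxDegree G
  greedy-class≤maxDegree {cl} (_ , sees) v = ℕ.≤-trans
    (subst (cl v ≤_) (sym (degree≡length v)) (injective⇒≤ position-injective))
    (degree≤maxDegree v)
    where
    neighbours : List (Fin n)
    neighbours = filter (Edge? v) (allFin n)

    seen : (i : Fin (cl v)) → ∃[ w ] (Edge G v w × cl w ≡ toℕ i)
    seen i = sees v (toℕ i) (toℕ<n i)

    ∈-neighbours : ∀ i → proj₁ (seen i) ∈ neighbours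
    ∈-neighbours i = ∈-filter⁺ (Edge? v) (∈-allFin _) (proj₁ (proj₂ (seen i)))

    position : Fin (cl v) → Fin (length neighbours)
    position i = index (∈-neighbours i)

    position-injective : ∀ {i j} → position i ≡ position j → i ≡ j
    position-injective {i} {j} eq = toℕ-injective (begin
      toℕ i                                ≡⟨ proj₂ (proj₂ (seen i)) ⟨
      cl (proj₁ (seen i))                  ≡⟨ cong cl (lookup-index (∈-neighbours i)) ⟩
      cl (List.lookup neighbours (position i)) ≡⟨ cong (cl ∘ List.lookup neighbours) eq ⟩
      cl (List.lookup neighbours (position j)) ≡⟨ cong cl (lookup-index (∈-neighbours j)) ⟨
      cl (proj₁ (seen j))                  ≡⟨ proj₂ (proj₂ (seen j)) ⟩
      toℕ j                                ∎)
      where open ≡-Reasoning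

  -- Satisfying an edge from one of its ends

  SameEdge-flip : ∀ {a b u v} → SameEdge G a b u v → SameEdge G b a u v
  SameEdge-flip (inj₁ (p , q)) = inj₂ (q , p)
  SameEdge-flip (inj₂ (p , q)) = inj₁ (q , p)

  SameEdge-swap : ∀ {a b u v} → SameEdge G a b u v → SameEdge G a b v u
  SameEdge-swap (inj₁ p) = inj₂ p
  SameEdge-swap (inj₂ p) = inj₁ p

  module _ {k : ℕ} (c : EdgeColouring G k) where
    open EdgeColouring c

    private
      closed-swap : ∀ {u v a b} → InClosedNbhd G u v a b → InClosedNbhd G v u a b
      closed-swap (ab , inj₁ i) = ab , inj₂ i
      closed-swap (ab , inj₂ i) = ab , inj₁ i

    Satisfied-sym : ∀ {u v} → Satisfied G c u v → Satisfied G c v u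
    Satisfied-sym (α , a , b , (closed , ≢uv) , eq , unique) =
      α , a , b , (closed-swap closed , ≢uv ∘ SameEdge-swap) , eq ,
      λ x y → unique x y ∘ closed-swap

    -- The colour of `u w` occurs once at `u` and never at `v`. Its absence at `v` also shows that
    -- `u w` is not the edge `u v` itself.
    satisfied-at-one-end : ∀ {u v w} → Edge G u w →
      (∀ y → Edge G u y → col u y ≡ col u w → y ≡ w) →
      (∀ y → Edge G v y → col v y ≢ col u w) → Edge G u v → Satisfied G c u v
    satisfied-at-one-end {u} {v} {w} uw one none uv =
      col u w , u , w , ((uw , inj₁ (inj₁ refl)) , different) , refl , unique
      where
      different : ¬ SameEdge G u w u v
      different (inj₁ (_ , refl)) = none u (Edge-sym uv) (colSym v u (Edge-sym uv))
      different (inj₂ (refl , _)) = contradiction (trans (sym uv) (irrefl u)) λ ()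

      unique : ∀ x y → InClosedNbhd G u v x y → col x y ≡ col u w → SameEdge G x y u w
      unique x y (xy , inj₁ (inj₁ refl)) eq = inj₁ (refl , one y xy eq)
      unique x y (xy , inj₁ (inj₂ refl)) eq =
        inj₂ (one x (Edge-sym xy) (trans (colSym y x (Edge-sym xy)) eq) , refl)
      unique x y (xy , inj₂ (inj₁ refl)) eq = contradiction eq (none y xy)
      unique x y (xy , inj₂ (inj₂ refl)) eq =
        contradiction (trans (colSym y x (Edge-sym xy)) eq) (none x (Edge-sym xy))

  -- Designated neighbours, the core and its partners

  record Layering (cl : Fin n → ℕ) : Set₁ where
    field
      Core     : Pred (Fin n) 0ℓ
      Core?    : Decidable Core
      nb       : Fin n → ℕ → Fin n
      partner  : Fin n → Fin n
      proper   : ∀ {u v} → Edge G u v → cl u ≢ cl v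
      nb-edge  : ∀ {u k} → k < cl u → Edge G u (nb u k)
      nb-class : ∀ {u k} → k < cl u → cl (nb u k) ≡ k
      nb-core  : ∀ {u} → cl u ≡ 1 → Core (nb u 0)
      core-class      : ∀ {s} → Core s → cl s ≡ 0
      partner-class   : ∀ {s} → Core s → cl (partner s) ≡ 1
      partner-edge    : ∀ {s} → Core s → Edge G (partner s) s
      partner-private : ∀ {s s′} → Core s → Core s′ → Edge G (partner s) s′ → s′ ≡ s

  choose : {P : Fin n → Set} {A : Set} → Dec A → (A → ∃ P) → Fin n → Fin n
  choose (yes a) f _ = proj₁ (f a)
  choose (no _) _ d = d

  choose-correct : {P : Fin n → Set} {A : Set} (A? : Dec A) (f : A → ∃ P) (d : Fin n) →
    A → P (choose A? f d)
  choose-correct (yes a) f _ _ = proj₂ (f a)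
  choose-correct (no ¬a) _ _ a = contradiction a ¬a

  -- The set is minimal for the edges from class 1 to class 0. Core vertices lie in class 0 because
  -- each has a private neighbour for this relation.
  layering : ∀ {cl} → IsGreedy cl → Layering cl
  layering {cl} (cl-proper , sees) with minimal-dominating {E = λ y x → Edge G y x × cl y ≡ 1 × cl x ≡ 0}
    (λ y x → Edge? y x ×-dec ((cl y ℕ.≟ 1) ×-dec (cl x ℕ.≟ 0)))
  ... | Core , Core? , dominating , private-nb = record
    { Core = Core ; Core? = Core?
    ; nb = nb ; partner = partner
    ; proper = λ {u} {v} → cl-proper u v
    ; nb-edge = λ k< → proj₁ (nb-correct k<)
    ; nb-class = λ k< → proj₁ (proj₂ (nb-correct k<))
    ; nb-core = λ {u} u≡1 → proj₂ (proj₂ (nb-correct {u} {0} (subst (0 <_) (sym u≡1) (s≤s z≤n)))) u≡1 refl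
    ; core-class = λ Cs → proj₂ (proj₂ (proj₁ (partner-correct Cs)))
    ; partner-class = λ Cs → proj₁ (proj₂ (proj₁ (partner-correct Cs)))
    ; partner-edge = λ Cs → proj₁ (proj₁ (partner-correct Cs))
    ; partner-private = λ {s} {s′} Cs Cs′ e → proj₂ (partner-correct Cs) s′ Cs′
        (e , proj₁ (proj₂ (proj₁ (partner-correct Cs))) , proj₂ (proj₂ (proj₁ (partner-correct Cs′))))
    }
    where
    Good : Fin n → ℕ → Fin n → Set
    Good u k w = Edge G u w × cl w ≡ k × (cl u ≡ 1 → k ≡ 0 → Core w)

    good : ∀ u k → k < cl u → ∃ (Good u k)
    good u k k< with sees u k k< | cl u ℕ.≟ 1 | k ℕ.≟ 0
    ... | w , uw , w≡k | no u≢1 | _ = w , uw , w≡k , λ u≡1 → contradiction u≡1 u≢1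
    ... | w , uw , w≡k | yes _ | no k≢0 = w , uw , w≡k , λ _ k≡0 → contradiction k≡0 k≢0
    ... | w , uw , w≡k | yes u≡1 | yes refl with dominating u w (uw , u≡1 , w≡k)
    ...   | s , Cs , us , _ , s≡0 = s , us , s≡0 , λ _ _ → Cs

    nb : Fin n → ℕ → Fin n
    nb u k = choose (k <? cl u) (good u k) u

    nb-correct : ∀ {u k} → k < cl u → Good u k (nb u k)
    nb-correct {u} {k} = choose-correct (k <? cl u) (good u k) u

    partner : Fin n → Fin n
    partner s = choose (Core? s) (private-nb s) s

    partner-correct : ∀ {s} → Core s → (Edge G (partner s) s × cl (partner s) ≡ 1 × cl s ≡ 0) ×
      (∀ s′ → Core s′ → Edge G (partner s) s′ × cl (partner s) ≡ 1 × cl s′ ≡ 0 → s′ ≡ s)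
    partner-correct {s} = choose-correct (Core? s) (private-nb s) s

  -- Base colours

  module _ {cl : Fin n → ℕ} (layers : Layering cl)
           {N : ℕ} {L H : Set} (code : Code N L H) (cl<N : ∀ v → cl v < N) where
    open Layering layers
    open Code code

    -- The summands hold the bit colours, the colours of a level on edges to class 0 (`false`) or
    -- class 1 (`true`), the colour `mark` of the edges between core vertices and their partners,
    -- and `blank` for all other edges.
    Base : Set
    Base = H ⊎ ((L × Bool) ⊎ Bool)

    pattern high h  = inj₁ h
    pattern low ℓ b = inj₂ (inj₁ (ℓ , b))
    pattern mark    = inj₂ (inj₂ true)
    pattern blank   = inj₂ (inj₂ false)

    optional : Maybe H → Base
    optional = maybe′ high blank

    optional-injective : ∀ {x y} → optional x ≡ optional y → x ≡ y
    optional-injective {just _} {just _} refl = refl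
    optional-injective {nothing} {nothing} _ = refl

    Marked : Pred (Fin n) 0ℓ
    Marked u = cl u ≡ 1 × u ≡ partner (nb u 0)

    marked? : Decidable Marked
    marked? u = (cl u ℕ.≟ 1) ×-dec (u ≟ partner (nb u 0))

    rule : Fin n → ℕ → Base
    rule u zero with marked? u
    ... | yes _ = mark
    ... | no _  = low (lev (cl u)) false
    rule u (suc zero)    = low (lev (cl u)) true
    rule u (suc (suc i)) = optional (hi (cl u) i)

    rule-0 : ∀ u → (Marked u × rule u 0 ≡ mark) ⊎ (¬ Marked u × rule u 0 ≡ low (lev (cl u)) false)
    rule-0 u with marked? u
    ... | yes m = inj₁ (m , refl)
    ... | no ¬m = inj₂ (¬m , refl)

    rule-0≢blank : ∀ u → rule u 0 ≢ blank
    rule-0≢blank u eq with marked? u | eq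
    ... | yes _ | ()
    ... | no _ | ()

    rule-mark : ∀ u k → rule u k ≡ mark → k ≡ 0 × Marked u
    rule-mark u zero eq with marked? u | eq
    ... | yes m | _ = refl , m
    ... | no _ | ()
    rule-mark u (suc (suc k)) eq with hi (cl u) k | eq
    ... | just _ | ()
    ... | nothing | ()

    rule-low : ∀ u k {ℓ b} → rule u k ≡ low ℓ b → k ≡ (if b then 1 else 0) × lev (cl u) ≡ ℓ
    rule-low u zero eq with marked? u | eq
    ... | yes _ | ()
    ... | no _ | refl = refl , refl
    rule-low u (suc zero) refl = refl , refl
    rule-low u (suc (suc k)) eq with hi (cl u) k | eq
    ... | just _ | ()
    ... | nothing | ()

    rule-hi : ∀ u k {h} → rule u k ≡ high h → ∃[ i ] (k ≡ 2 + i × hi (cl u) i ≡ just h)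
    rule-hi u zero eq with marked? u | eq
    ... | yes _ | ()
    ... | no _ | ()
    rule-hi u (suc (suc k)) eq with hi (cl u) k in eq′ | eq
    ... | just _ | refl = k , refl , eq′
    ... | nothing | ()

    rule-high : ∀ u k {h} → rule u k ≡ high h → 2 ≤ k
    rule-high u k eq with rule-hi u k eq
    ... | i , refl , _ = s≤s (s≤s z≤n)

    -- Every colour except `blank` is reserved for a single target class: `mark` and the `false`
    -- colours for class 0, the `true` colours for class 1, and a bit colour for the class of its
    -- position.
    rule-injective : ∀ u k v l → rule u k ≡ rule v l → rule u k ≢ blank → k ≡ l
    rule-injective u k v l eq ≢blank = receivers-agree (rule u k) refl
      where
      receivers-agree : ∀ α → rule u k ≡ α → k ≡ l
      receivers-agree blank ru = contradiction ru ≢blank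
      receivers-agree mark ru = trans (proj₁ (rule-mark u k ru))
        (sym (proj₁ (rule-mark v l (trans (sym eq) ru))))
      receivers-agree (low _ _) ru = trans (proj₁ (rule-low u k ru))
        (sym (proj₁ (rule-low v l (trans (sym eq) ru))))
      receivers-agree (high _) ru with rule-hi u k ru | rule-hi v l (trans (sym eq) ru)
      ... | i , k≡ , p | j , l≡ , q = trans k≡ (trans (cong (2 +_) (hi-inj p q)) (sym l≡))

    down : Fin n → Fin n → Base
    down u w with w ≟ nb u (cl w)
    ... | yes _ = rule u (cl w)
    ... | no _  = blank

    down-inv : ∀ {u w} → down u w ≢ blank → w ≡ nb u (cl w) × rule u (cl w) ≡ down u w
    down-inv {u} {w} ≢blank with w ≟ nb u (cl w)
    ... | yes eq = eq , refl
    ... | no _ = contradiction refl ≢blank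

    -- The end of larger class decides; the classes of adjacent vertices differ.
    base : Fin n → Fin n → Base
    base u w with cl w <? cl u
    ... | yes _ = down u w
    ... | no _  = down w u

    base-sym : ∀ {u w} → Edge G u w → base u w ≡ base w u
    base-sym {u} {w} uw with cl w <? cl u | cl u <? cl w
    ... | yes w<u | yes u<w = contradiction w<u (ℕ.<-asym u<w)
    ... | yes _ | no _ = refl
    ... | no _ | yes _ = refl
    ... | no w≮u | no u≮w = contradiction (ℕ.≤-antisym (ℕ.≮⇒≥ w≮u) (ℕ.≮⇒≥ u≮w)) (proper uw)

    -- The end that coloured the edge u w with α.
    data Source (u w : Fin n) (α : Base) : Set where
      below : cl w < cl u → w ≡ nb u (cl w) → rule u (cl w) ≡ α → Source u w α
      above : cl u < cl w → u ≡ nb w (cl u) → rule w (cl u) ≡ α → Source u w α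

    base-inv : ∀ {u w α} → Edge G u w → base u w ≡ α → α ≢ blank → Source u w α
    base-inv {u} {w} uw refl ≢blank with cl w <? cl u
    ... | yes w<u = let p , q = down-inv ≢blank in below w<u p q
    ... | no w≮u = let p , q = down-inv ≢blank in above (ℕ.≤∧≢⇒< (ℕ.≮⇒≥ w≮u) (proper uw)) p q

    base-below : ∀ {u w} → cl w < cl u → w ≡ nb u (cl w) → base u w ≡ rule u (cl w)
    base-below {u} {w} w<u w≡ with cl w <? cl u
    ... | no w≮u = contradiction w<u w≮u
    ... | yes _ with w ≟ nb u (cl w)
    ...   | yes _ = refl
    ...   | no w≢ = contradiction w≡ w≢

    base-nb : ∀ {u k} → k < cl u → base u (nb u k) ≡ rule u k
    base-nb {u} k<u = trans
      (base-below (subst (_< cl u) (sym (nb-class k<u)) k<u) (cong (nb u) (sym (nb-class k<u))))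
      (cong (rule u) (nb-class k<u))

    -- A second such edge chosen by `u` would lead to class `k` too, hence to the same designated
    -- neighbour; one chosen by its other end would put `u` in class `k`.
    only-at-chooser : ∀ {u k} → k < cl u → rule u k ≢ blank →
      ∀ y → Edge G u y → base u y ≡ rule u k → y ≡ nb u k
    only-at-chooser {u} {k} k<u ≢blank y uy eq with base-inv uy eq ≢blank
    ... | below _ y≡ r = trans y≡ (cong (nb u) (sym (rule-injective u k u (cl y) (sym r) ≢blank)))
    ... | above _ _ r = contradiction (rule-injective u k y (cl u) (sym r) ≢blank) (ℕ.<⇒≢ k<u)

    -- The lower end of an edge with this colour has class `k`. That end is not `v`, so `v` would
    -- have chosen the colour itself.
    none-at-other : ∀ {u v k} → rule u k ≢ blank → k ≢ cl v → (k < cl v → rule v k ≢ rule u k) →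
      ∀ y → Edge G v y → base v y ≢ rule u k
    none-at-other {u} {v} {k} ≢blank k≢v differ y vy eq with base-inv vy eq ≢blank
    ... | above _ _ r = k≢v (rule-injective u k y (cl v) (sym r) ≢blank)
    ... | below y<v _ r with rule-injective u k v (cl y) (sym r) ≢blank
    ...   | refl = differ y<v r

    -- Flags next to the core-partner edges

    Attached : Fin n → Fin n × Fin n → Set
    Attached s (a , b) = Edge G a b × (a ≡ s ⊎ a ≡ partner s) × b ≢ s × b ≢ partner s

    attached? : ∀ s → Decidable (Attached s)
    attached? s (a , b) = Edge? a b ×-dec (((a ≟ s) ⊎-dec (a ≟ partner s)) ×-dec
      (¬? (b ≟ s) ×-dec ¬? (b ≟ partner s)))

    any-attached? : ∀ s → Dec (∃[ a ] ∃[ b ] Attached s (a , b))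
    any-attached? s = any? λ a → any? λ b → attached? s (a , b)

    hook : Fin n → Fin n × Fin n
    hook s with any-attached? s
    ... | yes (a , b , _) = a , b
    -- This default is not attached, as `s s` is no edge, so it causes no flag.
    ... | no _ = s , s

    hook-attached : ∀ {s a b} → Attached s (a , b) → Attached s (hook s)
    hook-attached {s} {a} {b} att with any-attached? s
    ... | yes (_ , _ , att′) = att′
    ... | no none = contradiction (a , b , att) none

    Flagged : Fin n → Fin n → Set
    Flagged u v = ∃[ s ] (Core s × Attached s (hook s) × SameEdge G u v (proj₁ (hook s)) (proj₂ (hook s)))

    flagged? : Decidable₂ Flagged
    flagged? u v = any? λ s → Core? s ×-dec (attached? s (hook s) ×-dec
      (((u ≟ _) ×-dec (v ≟ _)) ⊎-dec ((u ≟ _) ×-dec (v ≟ _))))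

    Flagged-sym : ∀ {u v} → Flagged u v → Flagged v u
    Flagged-sym (s , Cs , att , same) = s , Cs , att , SameEdge-flip same

    flag : Fin n → Fin n → Bool
    flag u v = does (flagged? u v)

    flag-sym : ∀ u v → flag u v ≡ flag v u
    flag-sym u v with flagged? u v
    ... | yes f = sym (dec-true (flagged? v u) (Flagged-sym f))
    ... | no ¬f = sym (dec-false (flagged? v u) (¬f ∘ Flagged-sym))

    flag⇒Flagged : ∀ {u v} → flag u v ≡ true → Flagged u v
    flag⇒Flagged {u} {v} eq with flagged? u v | eq
    ... | yes f | _ = f
    ... | no _ | ()

    OnPair : Fin n → Fin n → Set
    OnPair s z = z ≡ s ⊎ z ≡ partner s

    same-class : ∀ {u v i} → cl u ≡ i → cl v ≡ i → ¬ Edge G u v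
    same-class u≡ v≡ uv = proper uv (trans u≡ (sym v≡))

    core≢partner : ∀ {s s′} → Core s → Core s′ → s ≢ partner s′
    core≢partner Cs Cs′ refl = contradiction (trans (sym (core-class Cs)) (partner-class Cs′)) λ ()

    pairs-disjoint : ∀ {s s′ z} → Core s → Core s′ → OnPair s z → OnPair s′ z → s′ ≡ s
    pairs-disjoint Cs Cs′ (inj₁ refl) (inj₁ eq) = sym eq
    pairs-disjoint Cs Cs′ (inj₁ refl) (inj₂ eq) = contradiction eq (core≢partner Cs Cs′)
    pairs-disjoint Cs Cs′ (inj₂ refl) (inj₁ eq) = contradiction (sym eq) (core≢partner Cs′ Cs)
    pairs-disjoint {s} {s′} Cs Cs′ (inj₂ refl) (inj₂ eq) =
      partner-private Cs Cs′ (subst (λ z → Edge G z s′) (sym eq) (partner-edge Cs′))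

    -- Within class 0 or class 1 there are no edges, and a partner has no core neighbour but its
    -- own.
    pairs-induced : ∀ {s s′ a b} → Core s → Core s′ → OnPair s a → OnPair s′ b → Edge G a b → s′ ≡ s
    pairs-induced Cs Cs′ (inj₁ refl) (inj₁ refl) ab =
      contradiction ab (same-class (core-class Cs) (core-class Cs′))
    pairs-induced Cs Cs′ (inj₁ refl) (inj₂ refl) ab = sym (partner-private Cs′ Cs (Edge-sym ab))
    pairs-induced Cs Cs′ (inj₂ refl) (inj₁ refl) ab = partner-private Cs Cs′ ab
    pairs-induced Cs Cs′ (inj₂ refl) (inj₂ refl) ab =
      contradiction ab (same-class (partner-class Cs) (partner-class Cs′))

    -- A flag of another pair ending at `z` would either put `z` on two pairs or join two pairs by
    -- an edge. A flag of the pair itself has only its first end on the pair.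
    flag-at-pair : ∀ {s z y} → Core s → OnPair s z → Flagged z y →
      z ≡ proj₁ (hook s) × y ≡ proj₂ (hook s)
    flag-at-pair {s} Cs on (s′ , Cs′ , (_ , on′ , _) , inj₁ (refl , refl))
      with pairs-disjoint Cs Cs′ on on′
    ... | refl = refl , refl
    flag-at-pair {s} Cs on (s′ , Cs′ , (ab , on′ , b≢s , b≢p) , inj₂ (refl , refl))
      with pairs-induced Cs Cs′ on on′ (Edge-sym ab)
    ... | refl = contradiction on [ b≢s , b≢p ]′

    -- Flagged edges never have a high base colour, so the T + S high colours need no flag.
    Paint : Set
    Paint = H ⊎ (((L × Bool) ⊎ Bool) × Bool)

    paint : Base → Bool → Paint
    paint (inj₁ h) _ = inj₁ h
    paint (inj₂ x) f = inj₂ (x , f)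

    paint-base : ∀ x y {f g} → paint x f ≡ paint y g → x ≡ y
    paint-base (inj₁ _) (inj₁ _) refl = refl
    paint-base (inj₂ _) (inj₂ _) refl = refl

    paint-flag : ∀ x y {f g} → (∀ h → x ≢ high h) → paint x f ≡ paint y g → f ≡ g
    paint-flag (inj₁ h) _ not-high _ = contradiction refl (not-high h)
    paint-flag (inj₂ _) (inj₂ _) _ refl = refl

    -- Conflict-freeness of the colouring

    module _ {k : ℕ} (encode : Paint ↔ Fin k) where

      private
        enc-injective : ∀ {x y} → Inverse.to encode x ≡ Inverse.to encode y → x ≡ y
        enc-injective {x} {y} eq = trans (sym (Inverse.strictlyInverseʳ encode x))
          (trans (cong (Inverse.from encode) eq) (Inverse.strictlyInverseʳ encode y))

      colouring : EdgeColouring G k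
      colouring = record
        { col = λ u v → Inverse.to encode (paint (base u v) (flag u v))
        ; colSym = λ u v uv → cong (Inverse.to encode) (cong₂ paint (base-sym uv) (flag-sym u v)) }

      open EdgeColouring colouring

      base-of : ∀ {u v x y} → col u v ≡ col x y → base u v ≡ base x y
      base-of {u} {v} {x} {y} eq = paint-base (base u v) (base x y) (enc-injective eq)

      -- Flags only split base colours, so a base colour occurring once still yields a colour
      -- occurring once.
      satisfied-by-base : ∀ {u v w} → Edge G u w →
        (∀ y → Edge G u y → base u y ≡ base u w → y ≡ w) →
        (∀ y → Edge G v y → base v y ≢ base u w) → Edge G u v → Satisfied G colouring u v
      satisfied-by-base uw one none = satisfied-at-one-end colouring uw
        (λ y uy → one y uy ∘ base-of) (λ y vy → none y vy ∘ base-of)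

      satisfied-by-rule : ∀ {u v} k → k < cl u → rule u k ≢ blank → k ≢ cl v →
        (k < cl v → rule v k ≢ rule u k) → Edge G u v → Satisfied G colouring u v
      satisfied-by-rule {u} {v} k k<u ≢blank k≢v differ = satisfied-by-base (nb-edge k<u)
        (λ y uy eq → only-at-chooser k<u ≢blank y uy (trans eq (base-nb k<u)))
        (λ y vy eq → none-at-other {u} ≢blank k≢v differ y vy (trans eq (base-nb k<u)))

      -- As the edge is not isolated, some edge is attached to it. The chosen one is the only
      -- flagged edge at either end of the pair, so its colour is unique.
      satisfied-pair : ∀ {s} → Core s → NonIsolated G (partner s) s → Satisfied G colouring (partner s) s
      satisfied-pair {s} Cs (a , b , nbhd) = at-end (proj₁ (proj₂ att))
        where
        attach : InOpenNbhd G (partner s) s a b → Attached s (hook s)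
        attach ((ab , inc) , ≢e) = hook-attached (proj₂ (proj₂ (orient inc)))
          where
          orient : Incident G (partner s) a b ⊎ Incident G s a b → ∃[ x ] ∃[ y ] Attached s (x , y)
          orient (inj₁ (inj₁ refl)) = a , b , ab , inj₂ refl ,
            (λ { refl → ≢e (inj₁ (refl , refl)) }) , λ { refl → contradiction (trans (sym ab) (irrefl a)) λ () }
          orient (inj₁ (inj₂ refl)) = b , a , Edge-sym ab , inj₂ refl ,
            (λ { refl → ≢e (inj₂ (refl , refl)) }) , λ { refl → contradiction (trans (sym ab) (irrefl a)) λ () }
          orient (inj₂ (inj₁ refl)) = a , b , ab , inj₁ refl ,
            (λ { refl → contradiction (trans (sym ab) (irrefl a)) λ () }) , λ { refl → ≢e (inj₂ (refl , refl)) }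
          orient (inj₂ (inj₂ refl)) = b , a , Edge-sym ab , inj₁ refl ,
            (λ { refl → contradiction (trans (sym ab) (irrefl a)) λ () }) , λ { refl → ≢e (inj₁ (refl , refl)) }

        att : Attached s (hook s)
        att = attach nbhd

        p q : Fin n
        p = proj₁ (hook s)
        q = proj₂ (hook s)

        pair-class : ∀ {z} → OnPair s z → cl z < 2
        pair-class (inj₁ refl) = ℕ.≤-trans (s≤s (ℕ.≤-reflexive (core-class Cs))) (s≤s z≤n)
        pair-class (inj₂ refl) = s≤s (ℕ.≤-reflexive (partner-class Cs))

        -- A high colour needs a lower end of class at least 2, but `p` has class 0 or 1. So the
        -- flag is visible in the colour of `p q`.
        not-high : ∀ h → base p q ≢ high h
        not-high h eq with base-inv (proj₁ att) eq (λ ())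
        ... | below q<p _ r = ℕ.<⇒≱ (ℕ.<-trans q<p (pair-class (proj₁ (proj₂ att)))) (rule-high p (cl q) r)
        ... | above _ _ r = ℕ.<⇒≱ (pair-class (proj₁ (proj₂ att))) (rule-high q (cl p) r)

        flagged-too : ∀ z y → col z y ≡ col p q → Flagged z y
        flagged-too z y eq = flag⇒Flagged (trans
          (sym (paint-flag (base p q) (base z y) not-high (enc-injective (sym eq))))
          (dec-true (flagged? p q) (s , Cs , att , inj₁ (refl , refl))))

        one : ∀ y → Edge G p y → col p y ≡ col p q → y ≡ q
        one y _ eq = proj₂ (flag-at-pair Cs (proj₁ (proj₂ att)) (flagged-too p y eq))

        none : ∀ {z} → OnPair s z → z ≢ p → ∀ y → Edge G z y → col z y ≢ col p q
        none on z≢p y _ eq = z≢p (proj₁ (flag-at-pair Cs on (flagged-too _ y eq)))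

        at-end : OnPair s p → Satisfied G colouring (partner s) s
        at-end (inj₁ p≡s) = Satisfied-sym colouring (subst (λ z → Satisfied G colouring z (partner s)) p≡s
          (satisfied-at-one-end colouring (proj₁ att) one
            (none (inj₂ refl) λ eq → core≢partner Cs Cs (sym (trans eq p≡s)))
            (subst (λ z → Edge G z (partner s)) (sym p≡s) (Edge-sym (partner-edge Cs)))))
        at-end (inj₂ p≡t) = subst (λ z → Satisfied G colouring z s) p≡t
          (satisfied-at-one-end colouring (proj₁ att) one
            (none (inj₁ refl) λ eq → core≢partner Cs Cs (trans eq p≡t))
            (subst (λ z → Edge G z s) (sym p≡t) (partner-edge Cs)))

      -- If `v` is in the core and `u` is not its partner, the mark at `v` is unique. If `v` is not
      -- in the core, the colour of the edge from `u` to `nb u 0` is: at `v` it could only come from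
      -- a class 1 vertex designating `v`, which would place `v` in the core.
      satisfied-01 : ∀ {u v} → Edge G u v → cl u ≡ 1 → cl v ≡ 0 → NonIsolated G u v → Satisfied G colouring u v
      satisfied-01 {u} {v} uv u≡1 v≡0 non-isolated with Core? v | u ≟ partner v
      ... | yes Cv | yes refl = satisfied-pair Cv non-isolated
      ... | yes Cv | no u≢ = Satisfied-sym colouring
              (satisfied-by-base (Edge-sym (partner-edge Cv)) one none (Edge-sym uv))
        where
        t = partner v

        0<t : 0 < cl t
        0<t = subst (0 <_) (sym (partner-class Cv)) (s≤s z≤n)

        nb-t : nb t 0 ≡ v
        nb-t = partner-private Cv (nb-core (partner-class Cv)) (nb-edge 0<t)

        base-mark : base v t ≡ mark
        base-mark = begin
          base v t         ≡⟨ base-sym (Edge-sym (partner-edge Cv)) ⟩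
          base t v         ≡⟨ cong (base t) nb-t ⟨
          base t (nb t 0)  ≡⟨ base-nb 0<t ⟩
          rule t 0         ≡⟨ rule-t ⟩
          mark             ∎
          where
          open ≡-Reasoning
          rule-t : rule t 0 ≡ mark
          rule-t with rule-0 t
          ... | inj₁ (_ , r) = r
          ... | inj₂ (¬m , _) = contradiction (partner-class Cv , cong partner (sym nb-t)) ¬m

        one : ∀ y → Edge G v y → base v y ≡ base v t → y ≡ t
        one y vy eq with base-inv vy (trans eq base-mark) (λ ())
        ... | below y<v _ _ = contradiction (subst (cl y <_) v≡0 y<v) λ ()
        ... | above _ v≡nb r with rule-mark y (cl v) r
        ...   | _ , _ , y≡ = trans y≡ (cong partner (trans (cong (nb y) (sym v≡0)) (sym v≡nb)))

        none : ∀ y → Edge G u y → base u y ≢ base v t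
        none y uy eq with base-inv uy (trans eq base-mark) (λ ())
        ... | above _ _ r = contradiction (trans (sym u≡1) (proj₁ (rule-mark y (cl u) r))) λ ()
        -- A mark chosen by `u` makes it the partner of `nb u 0`; being adjacent to the core vertex
        -- `v`, it would be the partner of `v`.
        ... | below _ _ r with rule-mark u (cl y) r
        ...   | _ , _ , u≡ = u≢ (trans u≡ (cong partner (sym
                  (partner-private (nb-core u≡1) Cv (subst (λ z → Edge G z v) u≡ uv)))))
      satisfied-01 {u} {v} uv u≡1 v≡0 _ | no ¬Cv | _ = satisfied-by-base (nb-edge 0<u)
        (λ y uy eq → only-at-chooser 0<u (rule-0≢blank u) y uy (trans eq (base-nb 0<u))) none uv
        where
        0<u : 0 < cl u
        0<u = subst (0 <_) (sym u≡1) (s≤s z≤n)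

        class-1 : ∀ {y} → 0 < cl y → rule y 0 ≡ rule u 0 → cl y ≡ 1
        class-1 {y} 0<y eq with rule-0 u | rule-0 y
        ... | _ | inj₁ ((y≡1 , _) , _) = y≡1
        ... | inj₁ (_ , ru) | inj₂ (_ , ry) = contradiction (trans (sym ry) (trans eq ru)) λ ()
        ... | inj₂ (_ , ru) | inj₂ _ = lev-1 0<y
          (trans (proj₂ (rule-low y 0 (trans eq ru))) (cong lev u≡1))

        none : ∀ y → Edge G v y → base v y ≢ base u (nb u 0)
        none y vy eq with base-inv vy (trans eq (base-nb 0<u)) (rule-0≢blank u)
        ... | below y<v _ _ = contradiction (subst (cl y <_) v≡0 y<v) λ ()
        ... | above v<y v≡ r = ¬Cv (subst Core (sym (trans v≡ (cong (nb y) v≡0)))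
          (nb-core (class-1 (ℕ.≤-trans (s≤s z≤n) v<y) (subst (λ k → rule y k ≡ rule u 0) v≡0 r))))

      satisfied-by-level : ∀ {u v} → 2 ≤ cl u → 1 ≤ cl v → lev (cl u) ≢ lev (cl v) →
        Edge G u v → Satisfied G colouring u v
      satisfied-by-level {u} {v} 2≤u 1≤v levels≢ = satisfied-by-rule 0 (ℕ.≤-trans (s≤s z≤n) 2≤u)
        (rule-0≢blank u) (ℕ.<⇒≢ 1≤v) (λ _ → differ)
        where
        differ : rule v 0 ≢ rule u 0
        differ eq with rule-0 u
        ... | inj₁ ((u≡1 , _) , _) = ℕ.<⇒≢ 2≤u (sym u≡1)
        ... | inj₂ (_ , ru) = levels≢ (sym (proj₂ (rule-low v 0 (trans eq ru))))

      -- Whichever end has a colour at position `i` supplies the unique colour; if `u` has none,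
      -- then `v` does.
      satisfied-by-digit : ∀ {u v} i → 2 + i < cl u → 2 + i < cl v → hi (cl u) i ≢ hi (cl v) i →
        Edge G u v → Satisfied G colouring u v
      satisfied-by-digit {u} {v} i i<u i<v his≢ uv with hi (cl u) i in hu
      ... | just _ = satisfied-by-rule (2 + i) i<u (λ eq → contradiction (trans (sym (cong optional hu)) eq) λ ())
              (ℕ.<⇒≢ i<v) (λ _ eq → his≢ (sym (trans (optional-injective eq) hu))) uv
      ... | nothing = Satisfied-sym colouring (satisfied-by-rule (2 + i) i<v
              (λ eq → his≢ (sym (optional-injective eq)))
              (ℕ.<⇒≢ i<u) (λ _ eq → his≢ (trans (sym hu) (optional-injective eq))) (Edge-sym uv))

      satisfied-downward : ∀ {u v} → Edge G u v → cl v < cl u → NonIsolated G u v → Satisfied G colouring u v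
      satisfied-downward {u} {v} uv v<u non-isolated with cl v in v≡ | cl u in u≡
      ... | zero | suc zero = satisfied-01 uv u≡ v≡ non-isolated
      -- The edge from `u` to class 1 serves here, since a vertex of class 0 chooses no colours.
      ... | zero | suc (suc c) = satisfied-by-rule 1 (subst (1 <_) (sym u≡) (s≤s (s≤s z≤n))) (λ ())
              (λ eq → contradiction (trans eq v≡) λ ()) (λ 1<v → contradiction (subst (1 <_) v≡ 1<v) λ ()) uv
      ... | suc d | suc zero = contradiction v<u λ { (s≤s ()) }
      ... | suc zero | suc (suc c) = satisfied-by-level (subst (2 ≤_) (sym u≡) (s≤s (s≤s z≤n)))
              (subst (1 ≤_) (sym v≡) (s≤s z≤n)) levels≢ uv
        where
        levels≢ : lev (cl u) ≢ lev (cl v)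
        levels≢ eq with trans (sym u≡) (lev-1 (subst (0 <_) (sym u≡) (s≤s z≤n)) (trans eq (cong lev v≡)))
        ... | ()
      ... | suc (suc d) | suc (suc c) = by-code
        (hi-sep (subst (2 ≤_) (sym v≡) (s≤s (s≤s z≤n)))
                (subst (cl v <_) (sym u≡) (subst (_< 2 + c) (sym v≡) v<u)) (cl<N u))
        where
        by-code : lev (cl u) ≢ lev (cl v) ⊎ ∃[ i ] (2 + i < cl v × hi (cl u) i ≢ hi (cl v) i) →
          Satisfied G colouring u v
        by-code (inj₁ levels≢) = satisfied-by-level (subst (2 ≤_) (sym u≡) (s≤s (s≤s z≤n)))
          (subst (1 ≤_) (sym v≡) (s≤s z≤n)) levels≢ uv
        by-code (inj₂ (i , i<v , his≢)) = satisfied-by-digit i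
          (ℕ.<-trans i<v (subst (cl v <_) (sym u≡) (subst (_< 2 + c) (sym v≡) v<u))) i<v his≢ uv

      conflict-free : ConflictFree G colouring
      conflict-free u v uv non-isolated with ℕ.<-cmp (cl v) (cl u)
      ... | tri< v<u _ _ = satisfied-downward uv v<u non-isolated
      ... | tri≈ _ v≡u _ = contradiction (sym v≡u) (proper uv)
      ... | tri> _ _ u<v = Satisfied-sym colouring (satisfied-downward (Edge-sym uv) u<v (flip non-isolated))
        where
        flip : NonIsolated G u v → NonIsolated G v u
        flip (a , b , (ab , inj₁ i) , ≢e) = a , b , (ab , inj₂ i) , ≢e ∘ SameEdge-swap
        flip (a , b , (ab , inj₂ i) , ≢e) = a , b , (ab , inj₁ i) , ≢e ∘ SameEdge-swap

-- The number of colours and the conclusion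

paints↔Fin : ∀ S T → ((Fin S ⊎ Fin T) ⊎ ((((Fin (2 + S) ⊎ Fin 2) × Bool) ⊎ Bool) × Bool))
  ↔ Fin (S + T + ((2 + S + 2) * 2 + 2) * 2)
paints↔Fin S T = ↔-sym ((+↔⊎ ⊎-↔ low-paints) ↔-∘ +↔⊎)
  where
  levels : Fin ((2 + S + 2) * 2) ↔ ((Fin (2 + S) ⊎ Fin 2) × Bool)
  levels = (+↔⊎ ×-↔ 2↔Bool) ↔-∘ *↔×

  low-paints : Fin (((2 + S + 2) * 2 + 2) * 2) ↔ ((((Fin (2 + S) ⊎ Fin 2) × Bool) ⊎ Bool) × Bool)
  low-paints = (((levels ⊎-↔ 2↔Bool) ↔-∘ +↔⊎) ×-↔ 2↔Bool) ↔-∘ *↔×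

-- Here `suc p` over `suc q` plays the role of ε, and every positive real exceeds such a fraction.
-- The inequality is the bound on `k` multiplied by `suc q` and exponentiated.
theorem1 : (p q : ℕ) → ∃[ D ] ((G : Graph) → D ≤ maxDegree G →
    ∃[ k ] (HasCFColouring G k × 2 ^ (k * suc q) ≤ maxDegree G ^ (suc q + suc p)))
theorem1 p q =
  let D , enough = few-colours p q
  in  D , λ G D≤Δ →
    let T , Δ<2^T , 2^T≤ = binary-magnitude (maxDegree G)
        -- The argument `suc T` gives the bounds for `2 + T`, the number of classes below the large
        -- range.
        S , T+2≤2^S , 2^S≤ = binary-magnitude (suc T)
        _ , greedy = greedy-colouring G
        layers = layering G greedy
        code = binary-code S T T+2≤2^S
        small = λ v → ℕ.≤-trans (s≤s (greedy-class≤maxDegree G greedy v)) Δ<2^T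
    in  _ ,
        (colouring G layers code small (paints↔Fin S T) ,
         conflict-free G layers code small (paints↔Fin S T)) ,
        enough (maxDegree G) S T D≤Δ Δ<2^T 2^T≤ T+2≤2^S 2^S≤
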